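{- Let $\rho$ and $\tau$ be simple types. 1. If $\rho\trianglelefteq\tau$ then $rank(\rho)\le rank(\tau)$. 2. If $\rho\trianglelefteq\tau$ and $\pi$ is a path in (the tree of) $\rho$, then there is a path $\pi'$ in (the tree of) $\tau$ with $w(\pi)\sqsubseteq w(\pi')$.
   Context: Simple types are built from type variables (atoms) $a,b,c,\dots$ (many distinct atoms) with $\to$. Terms are simply typed $\lambda$-terms in Church style. Retraction: $\rho\trianglelefteq\tau$ means that there are a type environment $E$ and terms $C$ (the coder), $D$ (the decoder) with $E,(x:\rho)\vdash C:\tau$, $E\vdash D:\tau\to\rho$, $x\notin FV(D)$, and $DC=_{\beta\eta}x$. The types of the free variables declared in $E$ are arbitrary. Rank: $rank(a)=0$ for an atom $a$, and $rank(\tau_1\to\cdots\to\tau_n\to a)=1+\max\{rank(\tau_i)\mid i=1,\dots,n\}$ for $n\ge1$. Tree of a type: $tree(\sigma_1\to\cdots\to\sigma_n\to a)$ (with $a$ an atom) is the finite tree whose root is labeled $a$ and whose direct subtrees are $tree(\sigma_1),\dots,tree(\sigma_n)$. A path is a path from the root down to some node (not necessarily a leaf). For a path $\pi$, $w(\pi)$ is the word of type variables labeling the nodes of $\pi$, read bottom-up (so the root's label is the last letter). For words $w,v$ over the set of type variables, $w\sqsubseteq^0 v$ iff $w=w'aw''$ and $v=w'aaaw''$ for some letter $a$ and some words $w',w''$; $\sqsubseteq$ is the reflexive and transitive closure of $\sqsubseteq^0$. -}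

module Defs where

open import Data.List using (List; []; _∷_; [_]; _++_; _∷ʳ_)
open import Data.List.Membership.Propositional using (_∈_)
open import Data.List.Relation.Binary.Subset.Propositional using (_⊆_)
open import Data.List.Relation.Unary.Any using (here; there)
open import Data.Nat using (ℕ; zero; suc; _⊔_)
open import Data.Product using (Σ-syntax)
open import Relation.Binary.Construct.Closure.ReflexiveTransitive using (Star)
open import Relation.Binary.PropositionalEquality using (refl)

infix  9 `_
infixl 8 _·_
infixr 7 _⇒_
infix  4 _⊢_ _≈βη_ _⊴_ _⊑⁰_ _⊑_

Atom : Set
Atom = ℕ

data Ty : Set where
  `_  : Atom → Ty
  _⇒_ : Ty → Ty → Ty

Env : Set
Env = List Ty

-- Church-style terms, intrinsically typed and taken up to α-conversion
-- (de Bruijn variables are positions in the environment; the head of the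
-- list is the most recently bound variable).
data _⊢_ (Γ : Env) : Ty → Set where
  var : ∀ {σ} → σ ∈ Γ → Γ ⊢ σ
  ƛ   : ∀ {σ τ} → σ ∷ Γ ⊢ τ → Γ ⊢ σ ⇒ τ
  _·_ : ∀ {σ τ} → Γ ⊢ σ ⇒ τ → Γ ⊢ σ → Γ ⊢ τ

liftʳ : ∀ {Γ Δ : Env} {σ : Ty} → Γ ⊆ Δ → σ ∷ Γ ⊆ σ ∷ Δ
liftʳ r (here p)  = here p
liftʳ r (there i) = there (r i)

rename : ∀ {Γ Δ : Env} {τ : Ty} → Γ ⊆ Δ → Γ ⊢ τ → Δ ⊢ τ
rename r (var i) = var (r i)
rename r (ƛ M)   = ƛ (rename (liftʳ r) M)
rename r (M · N) = rename r M · rename r N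

weaken : ∀ {Γ σ τ} → Γ ⊢ τ → σ ∷ Γ ⊢ τ
weaken = rename there

Sub : Env → Env → Set
Sub Γ Δ = ∀ {σ} → σ ∈ Γ → Δ ⊢ σ

liftˢ : ∀ {Γ Δ σ} → Sub Γ Δ → Sub (σ ∷ Γ) (σ ∷ Δ)
liftˢ s (here p)  = var (here p)
liftˢ s (there i) = weaken (s i)

subst : ∀ {Γ Δ τ} → Sub Γ Δ → Γ ⊢ τ → Δ ⊢ τ
subst s (var i) = s i
subst s (ƛ M)   = ƛ (subst (liftˢ s) M)
subst s (M · N) = subst s M · subst s N

single : ∀ {Γ σ} → Γ ⊢ σ → Sub (σ ∷ Γ) Γ
single N (here refl) = N
single N (there i)   = var i

_[_]₀ : ∀ {Γ σ τ} → σ ∷ Γ ⊢ τ → Γ ⊢ σ → Γ ⊢ τ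
M [ N ]₀ = subst (single N) M

data _≈βη_ {Γ : Env} : ∀ {τ} → Γ ⊢ τ → Γ ⊢ τ → Set where
  β      : ∀ {σ τ} (M : σ ∷ Γ ⊢ τ) (N : Γ ⊢ σ) → ƛ M · N ≈βη M [ N ]₀
  η      : ∀ {σ τ} (M : Γ ⊢ σ ⇒ τ) → ƛ (weaken M · var (here refl)) ≈βη M
  ƛ-cong : ∀ {σ τ} {M M′ : σ ∷ Γ ⊢ τ} → M ≈βη M′ → ƛ M ≈βη ƛ M′
  ·-cong : ∀ {σ τ} {M M′ : Γ ⊢ σ ⇒ τ} {N N′ : Γ ⊢ σ} →
           M ≈βη M′ → N ≈βη N′ → M · N ≈βη M′ · N′
  reflβη : ∀ {τ} {M : Γ ⊢ τ} → M ≈βη M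
  symβη  : ∀ {τ} {M N : Γ ⊢ τ} → M ≈βη N → N ≈βη M
  transβη : ∀ {τ} {M N P : Γ ⊢ τ} → M ≈βη N → N ≈βη P → M ≈βη P

-- The distinguished variable x : ρ is the head of ρ ∷ E.  That x is not free
-- in D is expressed by typing D in E and weakening it for the equation D C = x.
_⊴_ : Ty → Ty → Set
ρ ⊴ τ =
  Σ[ E ∈ Env ] Σ[ C ∈ ρ ∷ E ⊢ τ ] Σ[ D ∈ E ⊢ τ ⇒ ρ ]
    (weaken D · C ≈βη var (here refl))

-- For τ = τ₁ ⇒ … ⇒ τₙ ⇒ ` a, maxArgRank τ is the maximum of the rank τᵢ
-- (0 when n = 0).
mutual
  rank : Ty → ℕ
  rank (` a)   = zero
  rank (σ ⇒ τ) = suc (rank σ ⊔ maxArgRank τ)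

  maxArgRank : Ty → ℕ
  maxArgRank (` a)   = zero
  maxArgRank (σ ⇒ τ) = rank σ ⊔ maxArgRank τ

data Tree : Set where
  node : Atom → List Tree → Tree

target : Ty → Atom
target (` a)   = a
target (σ ⇒ τ) = target τ

mutual
  tree : Ty → Tree
  tree τ = node (target τ) (subtrees τ)

  subtrees : Ty → List Tree
  subtrees (` a)   = []
  subtrees (σ ⇒ τ) = tree σ ∷ subtrees τ

-- A path starts at the root and may stop at any node.
data Path : Tree → Set where
  stop : ∀ {a ts} → Path (node a ts)
  down : ∀ {a ts t} → t ∈ ts → Path t → Path (node a ts)

Word : Set
Word = List Atom

-- Labels are read bottom-up: the label of the root is the last letter.
word : ∀ {t} → Path t → Word
word (stop {a})     = [ a ]
word (down {a} _ π) = word π ∷ʳ a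

data _⊑⁰_ : Word → Word → Set where
  triple : ∀ (w′ : Word) (a : Atom) (w″ : Word) →
           (w′ ++ a ∷ w″) ⊑⁰ (w′ ++ a ∷ a ∷ a ∷ w″)

_⊑_ : Word → Word → Set
_⊑_ = Star _⊑⁰_

{-# OPTIONS --safe #-}
module Submission where

-- Interpret terms in the Scott model, that is, by intersection types refining
-- simple types.  Give the j-th node from the bottom of the path π in ρ its own
-- token t_j over the atom labeling it, and refine ρ along π to the formula
-- φ = (… (t₀ ⇒ t₁) …) ⇒ t_n.  Reading D C = x at φ, with the variables of E
-- uninterpreted, gives a finite conjunction Φ of refinements of τ such that C
-- derives Φ from φ and D derives φ from Φ: Φ is intuitionistically equivalent
-- to φ.  A Kripke model has worlds u_n and v_n, the first forcing φ and the
-- second not, but u_n and v_n can only be told apart by a formula with a path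
-- whose word, read from the root, lies in t_n^odd … t₁^odd t₀^odd.  So Φ has
-- such a path, and forgetting the tokens yields π′.  Part 1 follows from part 2,
-- since the rank bounds the lengths of the paths and is attained.

open import Defs
open import Data.Empty using (⊥)
open import Data.List using (List; []; _∷_; [_]; _++_; _∷ʳ_; length)
open import Data.List.Membership.Propositional using (_∈_)
open import Data.List.Properties using (∷ʳ-++; ∷ʳ-injective; ∷-injectiveˡ; ++-assoc; length-++)
open import Data.List.Relation.Binary.Subset.Propositional using (_⊆_)
open import Data.List.Relation.Binary.Subset.Propositional.Properties
  using (Any-resp-⊆; xs⊆xs++ys; xs⊆ys++xs)
open import Data.List.Relation.Unary.All as All using (All; []; _∷_)
open import Data.List.Relation.Unary.All.Properties using (++⁺)
open import Data.List.Relation.Unary.Any as Any using (Any; here; there)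
open import Data.Nat using (ℕ; suc; _+_; _≤_; z≤n; s≤s; s≤s⁻¹)
open import Data.Nat.Properties
open import Data.Product using (_×_; _,_; proj₁; proj₂; Σ-syntax; ∃-syntax)
open import Data.Sum using (inj₁; inj₂)
open import Data.Unit using (⊤; tt)
open import Function using (_∘_; id; _⇔_; mk⇔; Equivalence)
open import Relation.Nullary using (contradiction)
open import Relation.Binary.Construct.Closure.ReflexiveTransitive using (Star; ε; _◅_; _◅◅_; gmap)
open import Relation.Binary.PropositionalEquality using (_≡_; refl; sym; trans; cong; subst₂)
  renaming (subst to transport)

open Equivalence using (to; from)

-- Intersection types refining simple types.

module Refinement (Token : Atom → Set) where

  infixr 7 _↦_
  infix  4 _≤ʳ_
  infixl 5 _,,_

  data Ref : Ty → Set where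
    tok : ∀ {a} → Token a → Ref (` a)
    _↦_ : ∀ {σ τ} → List (Ref σ) → Ref τ → Ref (σ ⇒ τ)

  data _≤ʳ_ : ∀ {σ} → Ref σ → Ref σ → Set where
    tok : ∀ {a} {t : Token a} → tok t ≤ʳ tok t
    _↦_ : ∀ {σ τ} {A B : List (Ref σ)} {φ ψ : Ref τ} →
          All (λ α → Any (_≤ʳ α) B) A → φ ≤ʳ ψ → A ↦ φ ≤ʳ B ↦ ψ

  mutual
    ≤ʳ-refl : ∀ {σ} {φ : Ref σ} → φ ≤ʳ φ
    ≤ʳ-refl {φ = tok _} = tok
    ≤ʳ-refl {φ = A ↦ φ} = ≤ʳ-refl* A id ↦ ≤ʳ-refl

    ≤ʳ-refl* : ∀ {σ} {B : List (Ref σ)} A → A ⊆ B → All (λ α → Any (_≤ʳ α) B) A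
    ≤ʳ-refl* []      A⊆B = []
    ≤ʳ-refl* (α ∷ A) A⊆B =
      Any.map (λ { refl → ≤ʳ-refl }) (A⊆B (here refl)) ∷ ≤ʳ-refl* A (A⊆B ∘ there)

  -- The element of the Scott model generated by A.
  ⟨_⟩ : ∀ {σ} → List (Ref σ) → Ref σ → Set
  ⟨ A ⟩ φ = Any (_≤ʳ φ) A

  mutual
    ≤ʳ-trans : ∀ {σ} {φ ψ χ : Ref σ} → φ ≤ʳ ψ → ψ ≤ʳ χ → φ ≤ʳ χ
    ≤ʳ-trans tok     tok     = tok
    ≤ʳ-trans (a ↦ p) (b ↦ q) = ≤ʳ-trans* a b ↦ ≤ʳ-trans p q

    ≤ʳ-trans* : ∀ {σ} {A B C : List (Ref σ)} → All ⟨ B ⟩ A → All ⟨ C ⟩ B → All ⟨ C ⟩ A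
    ≤ʳ-trans* []      b = []
    ≤ʳ-trans* (p ∷ a) b = ⟨⟩-cut p b ∷ ≤ʳ-trans* a b

    ⟨⟩-cut : ∀ {σ} {B C : List (Ref σ)} {α} → ⟨ B ⟩ α → All ⟨ C ⟩ B → ⟨ C ⟩ α
    ⟨⟩-cut (here p)  (c ∷ _) = ⟨⟩-up c p
    ⟨⟩-cut (there i) (_ ∷ b) = ⟨⟩-cut i b

    ⟨⟩-up : ∀ {σ} {A : List (Ref σ)} {φ ψ} → ⟨ A ⟩ φ → φ ≤ʳ ψ → ⟨ A ⟩ ψ
    ⟨⟩-up (here p)  q = here (≤ʳ-trans p q)
    ⟨⟩-up (there i) q = there (⟨⟩-up i q)

  Val : Env → Set₁
  Val Γ = ∀ {σ} → σ ∈ Γ → Ref σ → Set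

  _,,_ : ∀ {Γ σ} → Val Γ → (Ref σ → Set) → Val (σ ∷ Γ)
  (v ,, X) (here refl) = X
  (v ,, X) (there i)   = v i

  UpClosed : ∀ {Γ} → Val Γ → Set
  UpClosed v = ∀ {σ} (i : σ ∈ _) {φ ψ} → v i φ → φ ≤ʳ ψ → v i ψ

  -- Derivability in an intersection type system without a subsumption rule; `⟦⟧-up` makes
  -- subsumption admissible for up-closed valuations.
  ⟦_⟧ : ∀ {Γ τ} → Γ ⊢ τ → Val Γ → Ref τ → Set
  ⟦ var i ⟧ v φ       = v i φ
  ⟦ ƛ M ⟧   v (A ↦ φ) = ⟦ M ⟧ (v ,, ⟨ A ⟩) φ
  ⟦ M · N ⟧ v φ       = ∃[ A ] (⟦ M ⟧ v (A ↦ φ) × All (⟦ N ⟧ v) A)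

  infix 4 _⊑ᵛ_
  _⊑ᵛ_ : ∀ {Γ} → Val Γ → Val Γ → Set
  v ⊑ᵛ v′ = ∀ {σ} (i : σ ∈ _) {φ} → v i φ → v′ i φ

  ,,-mono : ∀ {Γ σ} {v v′ : Val Γ} {X Y : Ref σ → Set} → v ⊑ᵛ v′ →
            (∀ {φ} → X φ → Y φ) → (v ,, X) ⊑ᵛ (v′ ,, Y)
  ,,-mono f g (here refl) = g
  ,,-mono f g (there i)   = f i

  ⟦⟧-mono : ∀ {Γ τ} (M : Γ ⊢ τ) {v v′ : Val Γ} → v ⊑ᵛ v′ → ∀ {φ} → ⟦ M ⟧ v φ → ⟦ M ⟧ v′ φ
  ⟦⟧-mono (var i) f m = f i m
  ⟦⟧-mono (ƛ M) {v} {v′} f {A ↦ φ} m = ⟦⟧-mono M (,,-mono {v = v} {v′} f id) m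
  ⟦⟧-mono (M · N) f (A , m , n) = A , ⟦⟧-mono M f m , All.map (⟦⟧-mono N f) n

  ,,-up : ∀ {Γ σ} {v : Val Γ} (A : List (Ref σ)) → UpClosed v → UpClosed (v ,, ⟨ A ⟩)
  ,,-up A up (here refl) = ⟨⟩-up
  ,,-up A up (there i)   = up i

  ⟦⟧-up : ∀ {Γ τ} (M : Γ ⊢ τ) {v : Val Γ} → UpClosed v → ∀ {φ ψ} → ⟦ M ⟧ v φ → φ ≤ʳ ψ → ⟦ M ⟧ v ψ
  ⟦⟧-up (var i) up m p = up i m p
  ⟦⟧-up (ƛ M) {v} up m (_↦_ {B = B} a p) =
    ⟦⟧-up M (,,-up {v = v} B up) (⟦⟧-mono M (,,-mono {v = v} {v} (λ _ → id) (λ i → ⟨⟩-cut i a)) m) p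
  ⟦⟧-up (M · N) up (A , m , n) p = A , ⟦⟧-up M up m (≤ʳ-refl* A id ↦ p) , n

  ⟦⟧-rename : ∀ {Γ Δ τ} (r : Γ ⊆ Δ) (M : Γ ⊢ τ) {v : Val Δ} {φ} →
              ⟦ rename r M ⟧ v φ ⇔ ⟦ M ⟧ (v ∘ r) φ
  ⟦⟧-rename r (var i) = mk⇔ id id
  ⟦⟧-rename r (ƛ M) {v} {A ↦ φ} = mk⇔
    (λ m → ⟦⟧-mono M (λ { (here refl) → id ; (there i) → id }) (to   (⟦⟧-rename (liftʳ r) M) m))
    (λ m → from (⟦⟧-rename (liftʳ r) M) (⟦⟧-mono M (λ { (here refl) → id ; (there i) → id }) m))
  ⟦⟧-rename r (M · N) = mk⇔
    (λ { (A , m , n) → A , to   (⟦⟧-rename r M) m , All.map (to   (⟦⟧-rename r N)) n })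
    (λ { (A , m , n) → A , from (⟦⟧-rename r M) m , All.map (from (⟦⟧-rename r N)) n })

  ⟦⟧-subst : ∀ {Γ Δ τ} (s : Sub Γ Δ) (M : Γ ⊢ τ) {v : Val Δ} {φ} →
             ⟦ subst s M ⟧ v φ ⇔ ⟦ M ⟧ (λ i → ⟦ s i ⟧ v) φ
  ⟦⟧-subst s (var i) = mk⇔ id id
  ⟦⟧-subst s (ƛ M) {v} {A ↦ φ} = mk⇔
    (λ m → ⟦⟧-mono M (λ { (here refl) → id ; (there i) → to (⟦⟧-rename there (s i)) })
             (to (⟦⟧-subst (liftˢ s) M) m))
    (λ m → from (⟦⟧-subst (liftˢ s) M)
             (⟦⟧-mono M (λ { (here refl) → id ; (there i) → from (⟦⟧-rename there (s i)) }) m))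
  ⟦⟧-subst s (M · N) = mk⇔
    (λ { (A , m , n) → A , to   (⟦⟧-subst s M) m , All.map (to   (⟦⟧-subst s N)) n })
    (λ { (A , m , n) → A , from (⟦⟧-subst s M) m , All.map (from (⟦⟧-subst s N)) n })

  -- Continuity and invariance under βη.

  module _ {I : Set} (X : I → Set) where

    Approx : ∀ {Γ} → Val Γ → (List I → Val Γ) → Set
    Approx v F = ∀ {σ} (i : σ ∈ _) {φ} → v i φ → ∃[ A ] (All X A × F A i φ)

    Monotone : ∀ {Γ} → (List I → Val Γ) → Set
    Monotone F = ∀ {A B} → A ⊆ B → F A ⊑ᵛ F B

    mutual
      -- A derivation consults its valuation finitely often, and concatenation joins the finite
      -- parts used by subderivations. `F` is arbitrary so that it can be extended under a binder.
      continuous : ∀ {Γ τ} (M : Γ ⊢ τ) {v : Val Γ} {F : List I → Val Γ} →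
                   Monotone F → Approx v F →
                   ∀ {φ} → ⟦ M ⟧ v φ → ∃[ A ] (All X A × ⟦ M ⟧ (F A) φ)
      continuous (var i) mono approx m = approx i m
      continuous (ƛ M) {v} {F} mono approx {B ↦ φ} m =
        continuous M {F = λ A → F A ,, ⟨ B ⟩}
          (λ { A⊆B (here refl) → id ; A⊆B (there i) → mono A⊆B i })
          -- The bound variable already carries the finite list `B`.
          (λ { (here refl) b → [] , [] , b ; (there i) → approx i })
          m
      continuous (M · N) {F = F} mono approx (B , m , n) =
        let A₁ , x₁ , m′ = continuous M mono approx m
            A₂ , x₂ , n′ = continuous* N mono approx n
        in A₁ ++ A₂ , ++⁺ x₁ x₂ , B
         , ⟦⟧-mono M {v′ = F (A₁ ++ A₂)} (mono (xs⊆xs++ys A₁ A₂)) m′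
         , All.map (⟦⟧-mono N (mono (xs⊆ys++xs A₂ A₁))) n′

      continuous* : ∀ {Γ τ} (N : Γ ⊢ τ) {v : Val Γ} {F : List I → Val Γ} →
                    Monotone F → Approx v F →
                    ∀ {B} → All (⟦ N ⟧ v) B → ∃[ A ] (All X A × All (⟦ N ⟧ (F A)) B)
      continuous* N mono approx []      = [] , [] , []
      continuous* N {F = F} mono approx (n ∷ ns) =
        let A₁ , x₁ , n′  = continuous N mono approx n
            A₂ , x₂ , ns′ = continuous* N mono approx ns
        in A₁ ++ A₂ , ++⁺ x₁ x₂
         , ⟦⟧-mono N (mono (xs⊆xs++ys A₁ A₂)) n′ ∷ All.map (⟦⟧-mono N (mono (xs⊆ys++xs A₂ A₁))) ns′

  ⟨⟩-least : ∀ {Γ τ} (N : Γ ⊢ τ) {v : Val Γ} → UpClosed v →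
             ∀ {A φ} → All (⟦ N ⟧ v) A → ⟨ A ⟩ φ → ⟦ N ⟧ v φ
  ⟨⟩-least N up (n ∷ _) (here p)  = ⟦⟧-up N up n p
  ⟨⟩-least N up (_ ∷ n) (there i) = ⟨⟩-least N up n i

  -- Contraction needs only monotonicity and up-closure. For expansion, continuity supplies the
  -- conjunction `A` of those facts about `N` that `M` uses.
  ⟦⟧-β : ∀ {Γ σ τ} (M : σ ∷ Γ ⊢ τ) (N : Γ ⊢ σ) {v : Val Γ} → UpClosed v →
         ∀ {φ} → ⟦ ƛ M · N ⟧ v φ ⇔ ⟦ M [ N ]₀ ⟧ v φ
  ⟦⟧-β M N {v} up = mk⇔
    (λ { (A , m , n) → from (⟦⟧-subst (single N) M)
           (⟦⟧-mono M (λ { (here refl) → ⟨⟩-least N up n ; (there i) → id }) m) })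
    (λ m → let A , n , m′ = continuous (⟦ N ⟧ v) M {F = λ A → v ,, ⟨ A ⟩}
                 (λ { A⊆B (here refl) a → Any-resp-⊆ A⊆B a ; A⊆B (there i) → id })
                 (λ { (here refl) n → [ _ ] , n ∷ [] , here ≤ʳ-refl
                    ; (there i)   x → [] , [] , x })
                 (to (⟦⟧-subst (single N) M) m)
           in A , m′ , n)

  ⟦⟧-η : ∀ {Γ σ τ} (M : Γ ⊢ σ ⇒ τ) {v : Val Γ} → UpClosed v →
         ∀ {φ} → ⟦ ƛ (weaken M · var (here refl)) ⟧ v φ ⇔ ⟦ M ⟧ v φ
  ⟦⟧-η M up {A ↦ φ} = mk⇔
    (λ { (B , m , b) → ⟦⟧-up M up (to (⟦⟧-rename there M) m) (b ↦ ≤ʳ-refl) })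
    (λ m → A , from (⟦⟧-rename there M) m , ≤ʳ-refl* A id)

  ⟦⟧-≈ : ∀ {Γ τ} {M N : Γ ⊢ τ} → M ≈βη N → {v : Val Γ} → UpClosed v →
         ∀ {φ} → ⟦ M ⟧ v φ ⇔ ⟦ N ⟧ v φ
  ⟦⟧-≈ (β M N) up = ⟦⟧-β M N up
  ⟦⟧-≈ (η M)   up = ⟦⟧-η M up
  ⟦⟧-≈ (ƛ-cong e) {v} up {A ↦ φ} = ⟦⟧-≈ e (,,-up {v = v} A up)
  ⟦⟧-≈ (·-cong e f) up = mk⇔
    (λ { (A , m , n) → A , to   (⟦⟧-≈ e up) m , All.map (to   (⟦⟧-≈ f up)) n })
    (λ { (A , m , n) → A , from (⟦⟧-≈ e up) m , All.map (from (⟦⟧-≈ f up)) n })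
  ⟦⟧-≈ reflβη      up = mk⇔ id id
  ⟦⟧-≈ (symβη e)   up = mk⇔ (from (⟦⟧-≈ e up)) (to (⟦⟧-≈ e up))
  ⟦⟧-≈ (transβη e f) up = mk⇔ (to (⟦⟧-≈ f up) ∘ to (⟦⟧-≈ e up)) (from (⟦⟧-≈ e up) ∘ from (⟦⟧-≈ f up))

  ∅ : ∀ {Γ} → Val Γ
  ∅ _ _ = ⊥

  -- The equation is used backwards: `x` has `φ`, hence so has the application, whose meaning
  -- provides `A`. As `D` is weakened, its derivation does not see `x`.
  interpolant : ∀ {ρ τ} → ρ ⊴ τ → (φ : Ref ρ) →
    ∃[ E ] Σ[ C ∈ ρ ∷ E ⊢ τ ] Σ[ D ∈ E ⊢ τ ⇒ ρ ] ∃[ A ]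
      (All (⟦ C ⟧ (∅ ,, ⟨ [ φ ] ⟩)) A × ⟦ D ⟧ ∅ (A ↦ φ))
  interpolant (E , C , D , e) φ =
    let A , d , c = from (⟦⟧-≈ e {∅ ,, ⟨ [ φ ] ⟩} (,,-up {v = ∅} [ φ ] λ _ ())) (here ≤ʳ-refl)
    in E , C , D , A , c , to (⟦⟧-rename there D) d

-- Words and prefixes.

⊑-∷ʳ : ∀ {x y} a → x ⊑ y → x ∷ʳ a ⊑ y ∷ʳ a
⊑-∷ʳ a = gmap (_∷ʳ a) step
  where
  step : ∀ {x y} → x ⊑⁰ y → x ∷ʳ a ⊑⁰ y ∷ʳ a
  step (triple x b y) = subst₂ _⊑⁰_
    (sym (++-assoc x (b ∷ y) [ a ])) (sym (++-assoc x (b ∷ b ∷ b ∷ y) [ a ]))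
    (triple x b (y ∷ʳ a))

⊑-triple : ∀ x a → x ∷ʳ a ⊑ x ∷ʳ a ∷ʳ a ∷ʳ a
⊑-triple x a = transport (x ∷ʳ a ⊑_)
  (sym (trans (∷ʳ-++ (x ∷ʳ a) a [ a ]) (∷ʳ-++ x a (a ∷ a ∷ []))))
  (triple x a [] ◅ ε)

⊑-length : ∀ {x y} → x ⊑ y → length x ≤ length y
⊑-length ε = ≤-refl
⊑-length (triple x a y ◅ r) = ≤-trans
  (begin
    length (x ++ a ∷ y)               ≡⟨ length-++ x ⟩
    length x + length (a ∷ y)         ≤⟨ +-monoʳ-≤ (length x) (≤-trans (n≤1+n _) (n≤1+n _)) ⟩
    length x + length (a ∷ a ∷ a ∷ y) ≡⟨ length-++ x ⟨
    length (x ++ a ∷ a ∷ a ∷ y)       ∎)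
  (⊑-length r)
  where open ≤-Reasoning

height : ∀ {t} → Path t → ℕ
height stop       = 0
height (down _ π) = suc (height π)

length-∷ʳ : ∀ (x : Word) a → length (x ∷ʳ a) ≡ suc (length x)
length-∷ʳ x a = trans (length-++ x) (+-comm (length x) 1)

length-word : ∀ {t} (π : Path t) → length (word π) ≡ suc (height π)
length-word stop           = refl
length-word (down {a} _ π) = trans (length-∷ʳ (word π) a) (cong suc (length-word π))

prefixOf : (ℕ → Atom) → ℕ → Word
prefixOf ℓ 0       = [ ℓ 0 ]
prefixOf ℓ (suc k) = prefixOf ℓ k ∷ʳ ℓ (suc k)

letter : Word → ℕ → Atom
letter []      _       = 0
letter (a ∷ x) 0       = a
letter (a ∷ x) (suc k) = letter x k

prefixOf-triple : ∀ ℓ k → prefixOf ℓ k ⊑ prefixOf ℓ k ∷ʳ ℓ k ∷ʳ ℓ k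
prefixOf-triple ℓ 0       = ⊑-triple [] (ℓ 0)
prefixOf-triple ℓ (suc k) = ⊑-triple (prefixOf ℓ k) (ℓ (suc k))

prefixOf-suc : ∀ ℓ k → prefixOf ℓ (suc k) ≡ ℓ 0 ∷ prefixOf (ℓ ∘ suc) k
prefixOf-suc ℓ 0       = refl
prefixOf-suc ℓ (suc k) = cong (_∷ʳ ℓ (suc (suc k))) (prefixOf-suc ℓ k)

prefixOf-letter : ∀ x {k} → length x ≡ suc k → prefixOf (letter x) k ≡ x
prefixOf-letter (a ∷ [])    refl = refl
prefixOf-letter (a ∷ b ∷ x) refl =
  trans (prefixOf-suc (letter (a ∷ b ∷ x)) (length x)) (cong (a ∷_) (prefixOf-letter (b ∷ x) refl))

-- The Kripke model.

-- False atoms are interpreted by Goal instead of ⊥, so that the proof yields an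
-- element of Goal constructively.
module Kripke (ℓ : ℕ → Atom) (Goal : Set) where

  -- The index keeps apart nodes of the path that carry the same atom.
  Token : Atom → Set
  Token a = ∃[ j ] (ℓ j ≡ a)

  open Refinement Token public

  prefix : ℕ → Word
  prefix = prefixOf ℓ

  data World : Set where
    u v : ℕ → World

  infix 4 _⟶_ _≼_ _⊩_ _⊩*_ _⊩ᵃ_

  data _⟶_ : World → World → Set where
    uu : ∀ {k} → u (suc k) ⟶ u k
    uv : ∀ {k} → u (suc k) ⟶ v k
    vu : ∀ {k} → v (suc k) ⟶ u k

  _≼_ : World → World → Set
  _≼_ = Star _⟶_

  -- Token j is false at level k iff j ≤ k, except that t₀ is true at u 0 and v 1.
  False : World → ℕ → Set
  False (u 0)             j = ⊥
  False (u (suc k))       j = j ≤ suc k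
  False (v 0)             j = j ≤ 0
  False (v 1)             j = j ≡ 1
  False (v (suc (suc k))) j = j ≤ suc (suc k)

  Holds : World → ℕ → Set
  Holds w j = False w j → Goal

  -- The exceptions for t₀ respect persistence: `u 0` has no successor, and `v 1` has only `u 0`.
  False-⟶ : ∀ {w w′ j} → w ⟶ w′ → False w′ j → False w j
  False-⟶ (uu {suc k})             p    = m≤n⇒m≤1+n p
  False-⟶ (uv {0})                 p    = m≤n⇒m≤1+n p
  False-⟶ (uv {1})                 refl = s≤s z≤n
  False-⟶ (uv {suc (suc k)})       p    = m≤n⇒m≤1+n p
  False-⟶ (vu {suc k})             p    = m≤n⇒m≤1+n p

  Holds-≼ : ∀ {w w′ j} → w ≼ w′ → Holds w j → Holds w′ j
  Holds-≼ ε       h = h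
  Holds-≼ (s ◅ r) h = Holds-≼ r (h ∘ False-⟶ s)

  False-v : ∀ k → False (v (suc k)) (suc k)
  False-v 0       = refl
  False-v (suc k) = ≤-refl

  head : ∀ {σ} → Ref σ → ℕ
  head (tok (j , _)) = j
  head (A ↦ φ)       = head φ

  ℓ-head : ∀ {σ j} (φ : Ref σ) → head φ ≡ j → ℓ j ≡ target σ
  ℓ-head (tok (_ , p)) refl = p
  ℓ-head (A ↦ φ)       e    = ℓ-head φ e

  -- Forcing and soundness.

  -- Forcing of A₁ ↦ … ↦ A_n ↦ t, with all the premises evaluated at once at the
  -- same later world.
  mutual
    _⊩_ : ∀ {σ} → World → Ref σ → Set
    w ⊩ φ = ∀ {w′} → w ≼ w′ → w′ ⊩ᵃ φ → Holds w′ (head φ)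

    _⊩ᵃ_ : ∀ {σ} → World → Ref σ → Set
    w ⊩ᵃ tok _   = ⊤
    w ⊩ᵃ (A ↦ φ) = w ⊩* A × w ⊩ᵃ φ

    _⊩*_ : ∀ {σ} → World → List (Ref σ) → Set
    w ⊩* []      = ⊤
    w ⊩* (α ∷ A) = w ⊩ α × w ⊩* A

  All⇒⊩* : ∀ {σ w} {A : List (Ref σ)} → All (w ⊩_) A → w ⊩* A
  All⇒⊩* []      = tt
  All⇒⊩* (a ∷ b) = a , All⇒⊩* b

  ⊩-≼ : ∀ {σ w w′} {φ : Ref σ} → w ≼ w′ → w ⊩ φ → w′ ⊩ φ
  ⊩-≼ r f r′ = f (r ◅◅ r′)

  ⊩*-≼ : ∀ {σ w w′} (A : List (Ref σ)) → w ≼ w′ → w ⊩* A → w′ ⊩* A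
  ⊩*-≼ []      r _       = tt
  ⊩*-≼ (α ∷ A) r (a , b) = ⊩-≼ {φ = α} r a , ⊩*-≼ A r b

  ⊩ᵃ-≼ : ∀ {σ w w′} (φ : Ref σ) → w ≼ w′ → w ⊩ᵃ φ → w′ ⊩ᵃ φ
  ⊩ᵃ-≼ (tok _) r _       = tt
  ⊩ᵃ-≼ (A ↦ φ) r (a , b) = ⊩*-≼ A r a , ⊩ᵃ-≼ φ r b

  ⊩-app : ∀ {σ τ w} {A : List (Ref σ)} {φ : Ref τ} → w ⊩ A ↦ φ → w ⊩* A → w ⊩ φ
  ⊩-app {A = A} f a r b = f r (⊩*-≼ A r a , b)

  ⊩-abs : ∀ {σ τ w} {A : List (Ref σ)} {φ : Ref τ} →
          (∀ {w′} → w ≼ w′ → w′ ⊩* A → w′ ⊩ φ) → w ⊩ A ↦ φ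
  ⊩-abs f r (a , b) = f r a ε b

  mutual
    ⊩-≤ʳ : ∀ {σ w} {φ ψ : Ref σ} → φ ≤ʳ ψ → w ⊩ φ → w ⊩ ψ
    ⊩-≤ʳ tok f = f
    ⊩-≤ʳ {φ = A ↦ φ} {B ↦ ψ} (a ↦ p) f = ⊩-abs {A = B} {ψ} λ r b →
      ⊩-≤ʳ p (⊩-app {A = A} {φ} (⊩-≼ {φ = A ↦ φ} r f) (⊩*-cut a b))

    ⊩*-cut : ∀ {σ w} {A B : List (Ref σ)} → All ⟨ B ⟩ A → w ⊩* B → w ⊩* A
    ⊩*-cut []      b = tt
    ⊩*-cut (p ∷ a) b = ⊩-⟨⟩ p b , ⊩*-cut a b

    ⊩-⟨⟩ : ∀ {σ w} {A : List (Ref σ)} {φ} → ⟨ A ⟩ φ → w ⊩* A → w ⊩ φ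
    ⊩-⟨⟩ (here {x = α} p) (a , _) = ⊩-≤ʳ {φ = α} p a
    ⊩-⟨⟩ (there i)        (_ , b) = ⊩-⟨⟩ i b

  infix 4 _⊩ᵛ_
  _⊩ᵛ_ : ∀ {Γ} → World → Val Γ → Set
  w ⊩ᵛ ξ = ∀ {σ} (i : σ ∈ _) {φ : Ref σ} → ξ i φ → w ⊩ φ

  ⊩ᵛ-,, : ∀ {Γ σ w} {ξ : Val Γ} {A : List (Ref σ)} → w ⊩ᵛ ξ → w ⊩* A → w ⊩ᵛ ξ ,, ⟨ A ⟩
  ⊩ᵛ-,, f a (here refl) p = ⊩-⟨⟩ p a
  ⊩ᵛ-,, f a (there i)   p = f i p

  sound : ∀ {Γ τ} (M : Γ ⊢ τ) {ξ : Val Γ} {w} → w ⊩ᵛ ξ → ∀ {φ} → ⟦ M ⟧ ξ φ → w ⊩ φ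
  sound (var i) f m = f i m
  sound (ƛ M) {ξ} f {A ↦ φ} m = ⊩-abs {A = A} {φ} λ r a →
    sound M (⊩ᵛ-,, {ξ = ξ} (λ i {ψ} p → ⊩-≼ {φ = ψ} r (f i p)) a) m
  sound (M · N) f {φ} (A , m , n) =
    ⊩-app {A = A} {φ} (sound M f m) (All⇒⊩* (All.map (sound N f) n))

  -- The automaton and transfer between worlds.

  -- States of an automaton reading a word of tokens from the root.  In odd k the
  -- language left to read is t_k^odd … t₀^odd; even k is reached after an odd
  -- number of t_(k+1), so that another one leads to odd (suc k) while t_k leads
  -- to even (k − 1), or to acceptance if k = 0.  Formulas without an accepted
  -- path transfer from src s to tgt s.
  data State : Set where
    odd even : ℕ → State

  src tgt : State → World
  src (odd k)  = u k
  src (even k) = v (suc k)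
  tgt (odd k)  = v k
  tgt (even k) = u (suc k)

  Accepts : State → Word → Set
  Accepts (odd k)  x = prefix k ⊑ x
  Accepts (even k) x = prefix (suc k) ⊑ x ∷ʳ ℓ (suc k)

  Refuted : State → Tree → Set
  Refuted s t = (π : Path t) → Accepts s (word π) → Goal

  module _ {σ : Ty} where

    RefutedArgs : State → Set
    RefutedArgs s = ∀ {t} → t ∈ subtrees σ → Refuted s t

    -- This and the next two lemmas are transitions read contrapositively: an accepted path in an
    -- argument, extended by the root, is accepted in the previous state.
    odd⇒even : ∀ {k} → Refuted (odd (suc k)) (tree σ) → ℓ (suc k) ≡ target σ → RefutedArgs (even k)
    odd⇒even h e i π p = h (down i π) (transport (λ a → _ ⊑ word π ∷ʳ a) e p)

    even⇒odd : ∀ {k} → Refuted (even k) (tree σ) → ℓ (suc k) ≡ target σ → RefutedArgs (odd (suc k))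
    even⇒odd {k} h e i π p = h (down i π)
      (transport (λ a → _ ⊑ word π ∷ʳ a ∷ʳ ℓ (suc k)) e
        -- The two extra copies are the root's label and the letter appended by `Accepts (even k)`.
        (prefixOf-triple ℓ (suc k) ◅◅ ⊑-∷ʳ _ (⊑-∷ʳ _ p)))

    even⇒even : ∀ {k} → Refuted (even (suc k)) (tree σ) → ℓ (suc k) ≡ target σ → RefutedArgs (even k)
    even⇒even {k} h e i π p = h (down i π)
      (transport (λ a → _ ⊑ word π ∷ʳ a ∷ʳ ℓ (suc (suc k))) e (⊑-∷ʳ _ p))

    odd-stop : Refuted (odd 0) (tree σ) → ℓ 0 ≡ target σ → Goal
    odd-stop h e = h stop (transport (λ a → _ ⊑ [ a ]) e ε)

    even-stop : Refuted (even 0) (tree σ) → ℓ 0 ≡ target σ → Goal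
    even-stop h e = h stop (transport (λ a → _ ⊑ a ∷ _ ∷ []) e ε)

  mutual
    -- A world below `tgt s` that forces the premises and falsifies the head is turned into such a
    -- world below `src s`, unless the root is accepted. A head at the top level moves the premises
    -- by `transferArgs`; a lower one is still false at a common lower world, where they persist.
    transfer : ∀ {σ} s (φ : Ref σ) → Refuted s (tree σ) → src s ⊩ φ → tgt s ⊩ φ
    transfer s φ h f r a p = transferAt s φ h (λ { r b refl → f r b }) r a refl p

    -- The head is a separate variable `j` so that falsity proofs can be matched.
    transferAt : ∀ {σ j} s (φ : Ref σ) → Refuted s (tree σ) →
      (∀ {w} → src s ≼ w → w ⊩ᵃ φ → head φ ≡ j → Holds w j) →
      ∀ {w} → tgt s ≼ w → w ⊩ᵃ φ → head φ ≡ j → Holds w j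
    transferAt (odd 0) φ h f ε a e z≤n = odd-stop h (ℓ-head φ e)
    transferAt (odd 1) φ h f ε a e refl =
      f ε (transferArgs (even 0) φ (odd⇒even h (ℓ-head φ e)) a) e ≤-refl
    transferAt (odd (suc (suc k))) φ h f ε a e p with m≤n⇒m<n∨m≡n p
    ... | inj₁ q    = f (uu ◅ ε) (⊩ᵃ-≼ φ (vu ◅ ε) a) e (s≤s⁻¹ q)
    ... | inj₂ refl =
      f ε (transferArgs (even (suc k)) φ (odd⇒even h (ℓ-head φ e)) a) e ≤-refl
    -- A proper successor of `v (suc k)` lies below `u k`, hence below `u (suc k)`.
    transferAt (odd (suc k)) φ h f (vu ◅ r) a e p = f (uu ◅ r) a e p
    transferAt (even k) φ h f ε a e p with m≤n⇒m<n∨m≡n p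
    transferAt (even k) φ h f ε a e p | inj₂ refl =
      f ε (transferArgs (odd (suc k)) φ (even⇒odd h (ℓ-head φ e)) a) e (False-v k)
    transferAt (even 0) φ h f ε a e p | inj₁ (s≤s z≤n) = even-stop h (ℓ-head φ e)
    transferAt (even (suc k)) φ h f ε a e p | inj₁ q = f (vu ◅ ε) (⊩ᵃ-≼ φ (uu ◅ ε) a) e (s≤s⁻¹ q)
    transferAt (even k) φ h f (uu ◅ r) a e p = f (vu ◅ r) a e p
    -- In this and the next two clauses the world is `v k`, which `v (suc k)` cannot reach. For k >
    -- 0 the premises are moved to `u k`, or persist one level lower.
    transferAt (even 0) φ h f (uv ◅ ε) a e z≤n = even-stop h (ℓ-head φ e)
    transferAt (even 1) φ h f (uv ◅ ε) a e refl =
      f (vu ◅ ε) (transferArgs (even 0) φ (even⇒even h (ℓ-head φ e)) a) e ≤-refl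
    transferAt (even (suc (suc k))) φ h f (uv ◅ ε) a e p with m≤n⇒m<n∨m≡n p
    ... | inj₁ q    = f (vu ◅ uu ◅ ε) (⊩ᵃ-≼ φ (vu ◅ ε) a) e (s≤s⁻¹ q)
    ... | inj₂ refl = f (vu ◅ ε)
      (transferArgs (even (suc k)) φ (even⇒even h (ℓ-head φ e)) a) e ≤-refl
    transferAt (even (suc k)) φ h f (uv ◅ vu ◅ r) a e p = f (vu ◅ uu ◅ r) a e p

    transferArgs : ∀ {σ} s (φ : Ref σ) → RefutedArgs {σ} s → src s ⊩ᵃ φ → tgt s ⊩ᵃ φ
    transferArgs s (tok _) h _       = tt
    transferArgs s (A ↦ φ) h (a , b) = transfer* s A (h (here refl)) a , transferArgs s φ (h ∘ there) b

    transfer* : ∀ {σ} s (A : List (Ref σ)) → Refuted s (tree σ) → src s ⊩* A → tgt s ⊩* A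
    transfer* s []      h _       = tt
    transfer* s (α ∷ A) h (a , b) = transfer s α h a , transfer* s A h b

  -- Separating formulas.

  record Separates {σ} (k : ℕ) (φ : Ref σ) : Set where
    field
      at-u  : u k ⊩ φ
      at-v  : v k ⊩ φ → Goal
      above : v (suc k) ⊩ φ

  open Separates

  separates-zero : ∀ {σ} (φ : Ref σ) → head φ ≡ 0 → (∀ w → w ⊩ᵃ φ) → Separates 0 φ
  separates-zero φ e all = record
    { at-u  = λ { ε _ () }
    ; at-v  = λ f → f ε (all _) (≤-reflexive e)
    ; above = λ { ε _ p → contradiction (trans (sym e) p) 0≢1+n ; (vu ◅ ε) _ () }
    }

  separates-suc : ∀ {σ τ k} (ψ : Ref σ) (φ : Ref τ) → head φ ≡ suc k →
                  (∀ w → w ⊩ᵃ φ ⇔ w ⊩ ψ) → Separates k ψ → Separates (suc k) φ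
  separates-suc {k = k} ψ φ e args s = record
    { at-u  = at-u′
    -- This is where `above` is needed: `v (suc k)` refutes the implication because it forces the
    -- premise `ψ`.
    ; at-v  = λ f → f ε (from (args _) (above s)) (False-head (False-v k))
    -- `v (suc (suc k))` reaches `v k`, where `ψ` fails, so it does not force the premise.
    ; above = λ { ε a _ → at-v s (⊩-≼ {φ = ψ} (vu ◅ uv ◅ ε) (to (args _) a))
                ; (vu ◅ r) → at-u′ r }
    }
    where
    False-head : ∀ {w} → False w (suc k) → False w (head φ)
    False-head {w} = transport (False w) (sym e)
    low-u : ∀ k → False (u k) (suc k) → Goal
    low-u (suc k)       p = contradiction p 1+n≰n
    low-v : ∀ k → False (v k) (suc k) → Goal
    low-v 1             ()
    low-v (suc (suc k)) p = contradiction p 1+n≰n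
    at-u′ : u (suc k) ⊩ φ
    at-u′ ε        a _ = at-v s (⊩-≼ {φ = ψ} (uv ◅ ε) (to (args _) a))
    at-u′ (uu ◅ r) a   = Holds-≼ r (low-u k ∘ transport (False _) e)
    at-u′ (uv ◅ r) a   = Holds-≼ r (low-v k ∘ transport (False _) e)

  leaf : ∀ ρ j → ℓ j ≡ target ρ → Σ[ φ ∈ Ref ρ ] (head φ ≡ j × ∀ w → w ⊩ᵃ φ)
  leaf (` a)   j e = tok (j , e) , refl , λ _ → tt
  leaf (σ ⇒ ρ) j e = let φ , h , f = leaf ρ j e in [] ↦ φ , h , λ w → tt , f w

  -- Arguments off the path get the empty conjunction, so the premises of `φ` amount to `ψ` alone.
  graft : ∀ ρ {t} → t ∈ subtrees ρ → ∃[ σ ] (t ≡ tree σ × ((ψ : Ref σ) → ∀ j → ℓ j ≡ target ρ →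
          Σ[ φ ∈ Ref ρ ] (head φ ≡ j × ∀ w → w ⊩ᵃ φ ⇔ w ⊩ ψ)))
  graft (σ ⇒ ρ) (here refl) = σ , refl , λ ψ j e →
    let φ , h , f = leaf ρ j e
    in [ ψ ] ↦ φ , h , λ w → mk⇔ (λ a → proj₁ (proj₁ a)) (λ x → ((λ {w′} → x {w′}) , tt) , f w)
  graft (σ ⇒ ρ) (there i) =
    let σ′ , t≡ , g = graft ρ i
    in σ′ , t≡ , λ ψ j e →
      let φ , h , f = g ψ j e
      in [] ↦ φ , h , λ w → mk⇔ (to (f w) ∘ proj₂) ((tt ,_) ∘ from (f w))

  probe : ∀ {t} (π : Path t) ρ → t ≡ tree ρ → prefix (height π) ≡ word π →
          Σ[ φ ∈ Ref ρ ] Separates (height π) φ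
  probe stop ρ refl e =
    let φ , h , f = leaf ρ 0 (∷-injectiveˡ e) in φ , separates-zero φ h f
  probe (down i π) ρ refl e =
    let e′ , e″      = ∷ʳ-injective (prefix (height π)) (word π) e
        σ , t≡ , g   = graft ρ i
        ψ , s        = probe π σ t≡ e′
        φ , h , args = g ψ (suc (height π)) e″
    in φ , separates-suc ψ φ h args s

  -- From a retraction to a path.

  ⊴⇒¬Refuted : ∀ {ρ τ} → ρ ⊴ τ → (π : Path (tree ρ)) → prefix (height π) ≡ word π →
               Refuted (odd (height π)) (tree τ) → Goal
  ⊴⇒¬Refuted {ρ} {τ} r π e h =
    let φ , s                 = probe π ρ refl e
        E , C , D , A , c , d = interpolant r φ
        k  = height π
        uA = All⇒⊩* (All.map (sound C (⊩ᵛ-,, {ξ = ∅} (λ _ ()) (at-u s , tt))) c)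
        vA = transfer* (odd k) A h uA
    -- With `E` uninterpreted, `D` is sound at every world, in particular at `v k`.
    in at-v s (⊩-app {A = A} {φ} (sound D (λ _ ()) d) vA)

⊴⇒⊑ : ∀ {ρ τ} → ρ ⊴ τ → (π : Path (tree ρ)) → ∃[ π′ ] (word π ⊑ word {tree τ} π′)
-- `Goal` is the desired existence statement, so an accepted path proves it directly.
⊴⇒⊑ r π = Kripke.⊴⇒¬Refuted (letter (word π)) _ r π e
  λ π′ p → π′ , transport (_⊑ word π′) e p
  where
  e : prefixOf (letter (word π)) (height π) ≡ word π
  e = prefixOf-letter (word π) (length-word π)

-- Rank and path height.

mutual
  height≤rank : ∀ σ (π : Path (tree σ)) → height π ≤ rank σ
  height≤rank σ       stop       = z≤n
  height≤rank (σ ⇒ τ) (down i π) = s≤s (height≤maxArgRank (σ ⇒ τ) i π)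

  height≤maxArgRank : ∀ σ {t} → t ∈ subtrees σ → (π : Path t) → height π ≤ maxArgRank σ
  height≤maxArgRank (σ ⇒ τ) (here refl) π = ≤-trans (height≤rank σ π) (m≤m⊔n _ _)
  height≤maxArgRank (σ ⇒ τ) (there i)   π = ≤-trans (height≤maxArgRank τ i π) (m≤n⊔m _ _)

mutual
  deepest : ∀ σ → Σ[ π ∈ Path (tree σ) ] rank σ ≤ height π
  deepest (` a)   = stop , z≤n
  deepest (σ ⇒ τ) = let _ , i , π , p = deepestArg σ τ in down i π , s≤s p

  deepestArg : ∀ σ τ → ∃[ t ] Σ[ i ∈ t ∈ subtrees (σ ⇒ τ) ] Σ[ π ∈ Path t ]
               maxArgRank (σ ⇒ τ) ≤ height π
  deepestArg σ (` a) =
    let π , p = deepest σ in _ , here refl , π , ≤-trans (≤-reflexive (⊔-identityʳ _)) p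
  deepestArg σ (τ ⇒ τ′) with ≤-total (maxArgRank (τ ⇒ τ′)) (rank σ)
  ... | inj₁ q = let π , p = deepest σ in _ , here refl , π , ⊔-lub p (≤-trans q p)
  ... | inj₂ q = let _ , i , π , p = deepestArg τ τ′ in _ , there i , π , ⊔-lub (≤-trans q p) p

proposition4p5 : (ρ τ : Ty) →
    (ρ ⊴ τ → rank ρ ≤ rank τ) ×
    (ρ ⊴ τ → (π : Path (tree ρ)) → ∃[ π′ ] (word π ⊑ word {tree τ} π′))
proposition4p5 ρ τ = rank-mono , ⊴⇒⊑
  where
  rank-mono : ρ ⊴ τ → rank ρ ≤ rank τ
  rank-mono r =
    let π , p  = deepest ρ
        π′ , q = ⊴⇒⊑ r π
    in begin
      rank ρ    ≤⟨ p ⟩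
      height π  ≤⟨ s≤s⁻¹ (≤-trans (≤-reflexive (sym (length-word π)))
                     (≤-trans (⊑-length q) (≤-reflexive (length-word π′)))) ⟩
      height π′ ≤⟨ height≤rank τ π′ ⟩
      rank τ    ∎
    where open ≤-Reasoning
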